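{- Let $\tilde L$ be a minimum-size counterexample. Then there are no elements $m,j\in\tilde L$ with $m$ meet-irreducible, $j$ join-irreducible, and $m<j$.
   Context: For a poset $P$, $x$ upper covers $y$ (and $y$ lower covers $x$) if $y<x$ with nothing strictly between. Join-irreducible: upper covers exactly one element; meet-irreducible: lower covers exactly one element. For $x\in P$, ${\uparrow}x=\{y: x\le y\}$. A counterexample is a finite lattice $L$ with $|L|>1$ in which every join-irreducible $j$ satisfies $|{\uparrow}j|>|L|/2$; a minimum-size counterexample is a counterexample $\tilde L$ such that no counterexample has fewer elements. -}

module Defs where

open import Data.Fin.Base using (Fin)
import Data.Fin.Properties as Fin
open import Data.Nat.Base using (ℕ; _*_; _<_; _>_)
open import Data.Product using (_×_; ∃; ∃!)
open import Data.Vec.Base using (Vec; tabulate; count)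
open import Function.Bundles using (Inverse)
open import Function.Properties.Inverse using (Inverse⇒Injection)
import Function.Construct.Symmetry as Symmetry
open import Level using (Level; suc; _⊔_)
open import Relation.Binary.Bundles using (Poset)
import Relation.Binary.Definitions as B
open import Relation.Binary.Lattice.Bundles using (Lattice)
import Relation.Binary.Properties.Poset as PosetProperties
import Relation.Binary.PropositionalEquality.Properties as ≡
open import Relation.Nullary.Negation.Core using (¬_)
open import Relation.Nullary.Decidable using (map′; via-injection)
open import Relation.Unary using (Pred; Decidable)

module _ {c ℓ₁ ℓ₂ : Level} (P : Poset c ℓ₁ ℓ₂) where
  open Poset P using (Carrier; _≈_; _≤_)
  open PosetProperties P using () renaming (_<_ to _≺_)

  UpperCovers : Carrier → Carrier → Set (c ⊔ ℓ₁ ⊔ ℓ₂)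
  UpperCovers x y = y ≺ x × ¬ (∃ λ z → y ≺ z × z ≺ x)

  LowerCovers : Carrier → Carrier → Set (c ⊔ ℓ₁ ⊔ ℓ₂)
  LowerCovers y x = UpperCovers x y

  JoinIrreducible : Pred Carrier (c ⊔ ℓ₁ ⊔ ℓ₂)
  JoinIrreducible x = ∃! _≈_ (UpperCovers x)

  MeetIrreducible : Pred Carrier (c ⊔ ℓ₁ ⊔ ℓ₂)
  MeetIrreducible x = ∃! _≈_ (LowerCovers x)

  ↑ : Carrier → Pred Carrier ℓ₂
  ↑ x y = x ≤ y

-- Elements are counted up to the lattice's own equality _≈_: the carrier, as a
-- setoid, is in bijection with Fin size.  This makes _≈_ decidable, and hence
-- also _≤_, because x ≤ y holds exactly when x ∧ y ≈ x.
record FiniteLattice (c ℓ₁ ℓ₂ : Level) : Set (suc (c ⊔ ℓ₁ ⊔ ℓ₂)) where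
  field
    lattice     : Lattice c ℓ₁ ℓ₂
    size        : ℕ
    enumeration : Inverse (≡.setoid (Fin size)) (Lattice.setoid lattice)

  open Lattice lattice public
  open PosetProperties poset public using () renaming (_<_ to _≺_)

  elements : Vec Carrier size
  elements = tabulate (Inverse.to enumeration)

  ∣_∣ : ∀ {p} {P : Pred Carrier p} → Decidable P → ℕ
  ∣ P? ∣ = count P? elements

  infix 4 _≈?_ _≤?_

  _≈?_ : B.Decidable _≈_
  _≈?_ = via-injection (Inverse⇒Injection (Symmetry.inverse enumeration)) Fin._≟_

  _≤?_ : B.Decidable _≤_
  x ≤? y = map′
    (λ x∧y≈x → trans (reflexive (Eq.sym x∧y≈x)) (x∧y≤y x y))
    (λ x≤y → antisym (x∧y≤x x y) (∧-greatest refl x≤y))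
    (x ∧ y ≈? x)

  ↑? : ∀ x → Decidable (↑ poset x)
  ↑? x y = x ≤? y

module _ {c ℓ₁ ℓ₂ : Level} where

  -- The condition |↑j| > |L|/2 is stated as 2|↑j| > |L|, since division in ℕ
  -- rounds down.
  Counterexample : Pred (FiniteLattice c ℓ₁ ℓ₂) (c ⊔ ℓ₁ ⊔ ℓ₂)
  Counterexample L =
    size > 1 × (∀ j → JoinIrreducible poset j → 2 * ∣ ↑? j ∣ > size)
    where open FiniteLattice L

  -- Competitors range over the universe levels of L; this loses nothing, since
  -- any finite lattice has an isomorphic copy on a lifted Fin n.
  MinimumSizeCounterexample : Pred (FiniteLattice c ℓ₁ ℓ₂) (suc (c ⊔ ℓ₁ ⊔ ℓ₂))
  MinimumSizeCounterexample L =
    Counterexample L ×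
    ¬ (∃ λ L′ → Counterexample L′ × FiniteLattice.size L′ < FiniteLattice.size L)

{-# OPTIONS --safe #-}

-- If m is meet-irreducible then L ∖ {m} is again a lattice, in which the join of
-- two elements that used to join to m becomes the unique upper cover m* of m.
-- The only element that can be join-irreducible in L ∖ {m} but not in L is m*.
-- If moreover m < j with j join-irreducible in L, then m* ≤ j, so every
-- join-irreducible k of L ∖ {m} lies below a join-irreducible p ≰ m of L: take
-- p = j when k ≤ j, and p = k otherwise.  The up-set of p is then untouched by
-- the deletion of m, so L ∖ {m} is a smaller counterexample whenever L is one.

module Submission where

open import Defs
open import Data.Fin.Base using (Fin; zero; suc; punchIn; punchOut)
open import Data.Fin.Induction using (spo-wellFounded)
open import Data.Fin.Properties using (any?; punchIn-injective; punchIn-punchOut; punchInᵢ≢i)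
open import Data.Nat.Base as ℕ using (ℕ; z≤n; s≤s; z<s)
import Data.Nat.Properties as ℕ
open import Data.Product.Base using (_×_; _,_; ∃-syntax; proj₁; proj₂)
open import Data.Vec.Base using (tabulate; count)
open import Data.Vec.Properties using (count≤n)
open import Function.Base using (_∘_; _on_)
open import Function.Bundles using (Inverse)
open import Induction.WellFounded using (WellFounded; Acc; acc)
open import Level using (Level; Lift; lift)
import Relation.Binary.Construct.On as On
open import Relation.Binary.Lattice.Bundles using (Lattice)
import Relation.Binary.Properties.Poset as PosetProperties
open import Relation.Binary.PropositionalEquality.Core as ≡ using (_≡_)
import Relation.Binary.PropositionalEquality.Properties as ≡
open import Relation.Nullary.Decidable using (Dec; yes; no; _×-dec_; ¬?)
open import Relation.Nullary.Negation.Core using (¬_; contradiction)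
open import Relation.Unary using (Pred; Decidable)

private
  variable
    a b p q c ℓ₁ ℓ₂ : Level
    A : Set a
    B : Set b

module _ {P : Pred A p} (P? : Decidable P) {Q : Pred B q} (Q? : Decidable Q) where

  count-tabulate-mono : ∀ {n} {f : Fin n → A} {g : Fin n → B} →
    (∀ i → P (f i) → Q (g i)) →
    count P? (tabulate f) ℕ.≤ count Q? (tabulate g)
  count-tabulate-mono {ℕ.zero} P⇒Q = z≤n
  count-tabulate-mono {ℕ.suc n} {f} {g} P⇒Q
    with P? (f zero) | Q? (g zero) | count-tabulate-mono (P⇒Q ∘ suc)
  ... | yes _  | yes _  | ih = s≤s ih
  ... | yes Pf | no ¬Qg | _  = contradiction (P⇒Q zero Pf) ¬Qg
  ... | no _   | yes _  | ih = ℕ.m≤n⇒m≤1+n ih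
  ... | no _   | no _   | ih = ih

  -- The entry at `i` contributes nothing to the left count, and `punchIn i` matches the other
  -- entries of `f` in order with those of `g`. This compares counts before and after an element is
  -- deleted.
  count-tabulate-punchIn-mono : ∀ {n} (i : Fin (ℕ.suc n)) {f : Fin (ℕ.suc n) → A} {g : Fin n → B} →
    ¬ P (f i) → (∀ k → P (f (punchIn i k)) → Q (g k)) →
    count P? (tabulate f) ℕ.≤ count Q? (tabulate g)
  count-tabulate-punchIn-mono zero {f} ¬Pf P⇒Q with P? (f zero)
  ... | yes Pf = contradiction Pf ¬Pf
  ... | no _   = count-tabulate-mono P⇒Q
  count-tabulate-punchIn-mono {ℕ.suc n} (suc i) {f} {g} ¬Pf P⇒Q
    with P? (f zero) | Q? (g zero) | count-tabulate-punchIn-mono i {f ∘ suc} ¬Pf (P⇒Q ∘ suc)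
  ... | yes _  | yes _  | ih = s≤s ih
  ... | yes Pf | no ¬Qg | _  = contradiction (P⇒Q zero Pf) ¬Qg
  ... | no _   | yes _  | ih = ℕ.m≤n⇒m≤1+n ih
  ... | no _   | no _   | ih = ih

module _ (L : FiniteLattice c ℓ₁ ℓ₂) where
  open FiniteLattice L
  open PosetProperties poset using (<-isStrictPartialOrder; <-respˡ-≈; <-respʳ-≈)
  open Inverse enumeration using (to; from; strictlyInverseˡ)

  _≺?_ : ∀ x y → Dec (x ≺ y)
  x ≺? y = (x ≤? y) ×-dec ¬? (x ≈? y)

  -- Well-founded descent from `x`: if some element lies strictly between `m` and `x`, descend to
  -- it; otherwise `x` itself covers `m` and equals `m*` by uniqueness. The descent runs on indices,
  -- where finiteness makes the strict order well-founded.
  upperCover-least : ∀ {m} ((m* , _) : MeetIrreducible poset m) → ∀ {x} → m ≺ x → m* ≤ x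
  upperCover-least {m} (m* , _ , unique) {x} m≺x =
    ≤-respʳ-≈ (strictlyInverseˡ x)
      (below (wf (from x)) (<-respʳ-≈ (Eq.sym (strictlyInverseˡ x)) m≺x))
    where
    wf : WellFounded (_≺_ on to)
    wf = spo-wellFounded (On.isStrictPartialOrder to <-isStrictPartialOrder)

    below : ∀ {i} → Acc (_≺_ on to) i → m ≺ to i → m* ≤ to i
    below {i} (acc rs) m≺i with any? (λ k → (m ≺? to k) ×-dec (to k ≺? to i))
    ... | yes (k , m≺k , k≺i) = trans (below (rs k≺i) m≺k) (proj₁ k≺i)
    ... | no none = reflexive (unique (m≺i , λ (z , m≺z , z≺i) →
      let z≈ = Eq.sym (strictlyInverseˡ z) in
      none (from z , <-respʳ-≈ z≈ m≺z , <-respˡ-≈ z≈ z≺i)))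

-- The size has the form `suc s` so that `punchIn (from m)` can list the `s` indices that remain.
module DeleteMeetIrreducible
  (lattice : Lattice c ℓ₁ ℓ₂) {s : ℕ}
  (enumeration : Inverse (≡.setoid (Fin (ℕ.suc s))) (Lattice.setoid lattice))
  where

  L : FiniteLattice c ℓ₁ ℓ₂
  L = record { lattice = lattice ; size = ℕ.suc s ; enumeration = enumeration }

  open FiniteLattice L hiding (lattice; size; enumeration)
  open PosetProperties poset using (<-respˡ-≈; <-respʳ-≈; <-trans; <⇒≱)
  open Inverse enumeration using (to; from; to-cong; strictlyInverseˡ; strictlyInverseʳ; from-cong)

  module _ {m : Carrier} (m-irr : MeetIrreducible poset m) where

    m* : Carrier
    m* = proj₁ m-irr

    m≺m* : m ≺ m*
    m≺m* = proj₁ (proj₁ (proj₂ m-irr))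

    m*-least : ∀ {x} → m ≺ x → m* ≤ x
    m*-least = upperCover-least L m-irr

    -- Lift puts the smaller lattice in the same universe levels as L.
    Carrier⁻ : Set c
    Carrier⁻ = Lift c (Fin s)

    embed : Carrier⁻ → Carrier
    embed (lift i) = to (punchIn (from m) i)

    m≉embed : ∀ k → ¬ m ≈ embed k
    m≉embed (lift i) m≈ = punchInᵢ≢i (from m) i
      (≡.trans (≡.sym (strictlyInverseʳ _)) (≡.sym (from-cong m≈)))

    restrict : ∀ x → ¬ m ≈ x → Carrier⁻
    restrict x m≉x = lift (punchOut (m≉x ∘ from-injective))
      where
      from-injective : from m ≡ from x → m ≈ x
      from-injective eq = Eq.trans (Eq.sym (strictlyInverseˡ m))
        (Eq.trans (to-cong eq) (strictlyInverseˡ x))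

    embed-restrict : ∀ {x} (m≉x : ¬ m ≈ x) → embed (restrict x m≉x) ≈ x
    embed-restrict {x} m≉x = Eq.trans (to-cong (punchIn-punchOut _)) (strictlyInverseˡ x)

    -- Rounding up into the remaining elements: only `m` moves, and it goes to `m*`. Applied to a
    -- join in `L`, this gives the join after deletion.
    ceiling : ∀ x → ∃[ k ] (x ≤ embed k × (∀ z → x ≤ embed z → embed k ≤ embed z))
    ceiling x with m ≈? x
    ... | no m≉x = restrict x m≉x
      , reflexive (Eq.sym (embed-restrict m≉x))
      , λ z → trans (reflexive (embed-restrict m≉x))
    ... | yes m≈x = restrict m* m≉m*
      , trans (reflexive (Eq.sym m≈x)) (trans (proj₁ m≺m*) (reflexive (Eq.sym (embed-restrict m≉m*))))
      , λ z x≤z → trans (reflexive (embed-restrict m≉m*))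
          (m*-least (trans (reflexive m≈x) x≤z , m≉embed z))
      where
      m≉m* : ¬ m ≈ m*
      m≉m* = proj₂ m≺m*

    -- Two remaining elements with meet `m` would both lie strictly above `m`, hence above `m*`,
    -- forcing `m* ≤ m`. So meets are inherited from `L` unchanged.
    m≉meet : ∀ k l → ¬ m ≈ embed k ∧ embed l
    m≉meet k l m≈ = <⇒≱ m≺m* (trans (∧-greatest
      (m*-least (trans (reflexive m≈) (x∧y≤x _ _) , m≉embed k))
      (m*-least (trans (reflexive m≈) (x∧y≤y _ _) , m≉embed l)))
      (reflexive (Eq.sym m≈)))

    lattice⁻ : Lattice c ℓ₁ ℓ₂
    lattice⁻ = record
      { Carrier = Carrier⁻
      ; _≈_ = _≈_ on embed
      ; _≤_ = _≤_ on embed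
      ; _∨_ = λ k l → proj₁ (ceiling (embed k ∨ embed l))
      ; _∧_ = λ k l → restrict (embed k ∧ embed l) (m≉meet k l)
      ; isLattice = record
        { isPartialOrder = On.isPartialOrder embed isPartialOrder
        ; supremum = λ k l →
            let _ , ≤ceil , least = ceiling (embed k ∨ embed l) in
            trans (x≤x∨y _ _) ≤ceil , trans (y≤x∨y _ _) ≤ceil ,
            λ z k≤z l≤z → least z (∨-least k≤z l≤z)
        ; infimum = λ k l →
            let r≈ = embed-restrict (m≉meet k l) in
            trans (reflexive r≈) (x∧y≤x _ _) , trans (reflexive r≈) (x∧y≤y _ _) ,
            λ z z≤k z≤l → trans (∧-greatest z≤k z≤l) (reflexive (Eq.sym r≈))
        }
      }

    L⁻ : FiniteLattice c ℓ₁ ℓ₂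
    L⁻ = record
      { lattice = lattice⁻
      ; size = s
      ; enumeration = record
        { to = lift
        ; from = λ (lift i) → i
        ; to-cong = λ { ≡.refl → Eq.refl }
        ; from-cong = embed-injective
        ; inverse = (λ { ≡.refl → Eq.refl }) , embed-injective
        }
      }
      where
      embed-injective : ∀ {k l} → embed k ≈ embed l → Lift.lower k ≡ Lift.lower l
      embed-injective eq = punchIn-injective (from m) _ _
        (≡.trans (≡.sym (strictlyInverseʳ _)) (≡.trans (from-cong eq) (strictlyInverseʳ _)))

    open FiniteLattice L⁻ using ()
      renaming (poset to poset⁻; ∣_∣ to ∣_∣⁻; ↑? to ↑?⁻; elements to elements⁻)

    module _ {k : Carrier⁻} (m*≉k : ¬ m* ≈ embed k) where

      m*≺ : m ≺ embed k → m* ≺ embed k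
      m*≺ m≺k = m*-least m≺k , m*≉k

      between : ∀ {y} → (∃[ z ] (y ≺ z × z ≺ embed k)) →
                ∃[ z ] (y ≺ embed z × embed z ≺ embed k)
      between (z , y≺z , z≺k) with m ≈? z
      ... | no m≉z =
        let z≈ = Eq.sym (embed-restrict m≉z) in
        restrict z m≉z , <-respʳ-≈ z≈ y≺z , <-respˡ-≈ z≈ z≺k
      -- An intermediate element equal to `m` has been deleted; `m*` takes its place, being still
      -- strictly below `embed k`.
      ... | yes m≈z =
        let z≈ = Eq.sym (embed-restrict (proj₂ m≺m*)) in
        restrict m* (proj₂ m≺m*)
        , <-respʳ-≈ z≈ (<-trans (<-respʳ-≈ (Eq.sym m≈z) y≺z) m≺m*)
        , <-respˡ-≈ z≈ (m*≺ (<-respˡ-≈ (Eq.sym m≈z) z≺k))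

      -- Away from `m*`, deletion changes no lower covers: `m` is never a lower cover of `embed k`,
      -- because `m*` would lie strictly between them.
      embed-joinIrreducible : JoinIrreducible poset⁻ k → JoinIrreducible poset (embed k)
      embed-joinIrreducible (l , (l≺k , none) , unique) =
        embed l , (l≺k , none ∘ between) , unique′
        where
        unique′ : ∀ {y} → UpperCovers poset (embed k) y → embed l ≈ y
        unique′ {y} (y≺k , none′) with m ≈? y
        ... | yes m≈y = contradiction
          (m* , <-respˡ-≈ m≈y m≺m* , m*≺ (<-respˡ-≈ (Eq.sym m≈y) y≺k)) none′
        ... | no m≉y =
          let y≈ = embed-restrict m≉y in
          Eq.trans (unique {restrict y m≉y} (<-respˡ-≈ (Eq.sym y≈) y≺k ,
            λ (z , y≺z , z≺k) → none′ (embed z , <-respˡ-≈ y≈ y≺z , z≺k))) y≈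

    joinIrreducible-above : ∀ {j} → JoinIrreducible poset j → m ≺ j →
      ∀ k → JoinIrreducible poset⁻ k →
      ∃[ p ] (JoinIrreducible poset p × embed k ≤ p × ¬ p ≤ m)
    joinIrreducible-above {j} j-irr m≺j k k-irr with embed k ≤? j
    ... | yes k≤j = j , j-irr , k≤j , <⇒≱ m≺j
    -- Since both `m*` and `m` are below `j`, an element not below `j` is neither `m*` nor below
    -- `m`.
    ... | no  k≰j = embed k
      , embed-joinIrreducible (λ m*≈k → k≰j (trans (reflexive (Eq.sym m*≈k)) (m*-least m≺j))) k-irr
      , refl
      , λ k≤m → k≰j (trans k≤m (proj₁ m≺j))

    -- The up-set of `p` avoids `m`, so it survives the deletion whole, and it is contained in the
    -- up-set of `k`.
    ∣↑∣≤∣↑∣⁻ : ∀ {p} k → embed k ≤ p → ¬ p ≤ m → ∣ ↑? p ∣ ℕ.≤ ∣ ↑?⁻ k ∣⁻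
    ∣↑∣≤∣↑∣⁻ {p} k k≤p p≰m = count-tabulate-punchIn-mono (↑? p) (↑?⁻ k) (from m) {f = to}
      (λ p≤ → p≰m (≤-respʳ-≈ (strictlyInverseˡ m) p≤)) (λ i → trans k≤p)

    counterexample⁻ : Counterexample L → ∀ {j} → JoinIrreducible poset j → m ≺ j → Counterexample L⁻
    counterexample⁻ (_ , large) {j} j-irr m≺j = s>1 , large⁻
      where
      ∣↑j∣≤s : ∣ ↑? j ∣ ℕ.≤ s
      ∣↑j∣≤s = ℕ.≤-trans
        (∣↑∣≤∣↑∣⁻ (restrict j (proj₂ m≺j)) (reflexive (embed-restrict (proj₂ m≺j))) (<⇒≱ m≺j))
        (count≤n (↑?⁻ _) elements⁻)

      s>1 : s ℕ.> 1
      -- As `↑ j` misses `m`, it has at most `s` elements, so largeness of `j` gives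
      -- `suc s < 2 * s`, which rules out `s` being 0 or 1.
      s>1 = 1+s<2*s⇒1<s (ℕ.<-≤-trans (large j j-irr) (ℕ.*-monoʳ-≤ 2 ∣↑j∣≤s))
        where
        1+s<2*s⇒1<s : ∀ {s} → ℕ.suc s ℕ.< 2 ℕ.* s → 1 ℕ.< s
        1+s<2*s⇒1<s {1} (s≤s (s≤s ()))
        1+s<2*s⇒1<s {ℕ.suc (ℕ.suc _)} _ = s≤s z<s

      large⁻ : ∀ k → JoinIrreducible poset⁻ k →
               2 ℕ.* ∣ ↑?⁻ k ∣⁻ ℕ.> s
      large⁻ k k-irr =
        let p , p-irr , k≤p , p≰m = joinIrreducible-above j-irr m≺j k k-irr in
        ℕ.<-trans (ℕ.n<1+n s)
          (ℕ.<-≤-trans (large p p-irr) (ℕ.*-monoʳ-≤ 2 (∣↑∣≤∣↑∣⁻ k k≤p p≰m)))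

theorem2p3 : ∀ {c ℓ₁ ℓ₂ : Level} (L : FiniteLattice c ℓ₁ ℓ₂) →
    MinimumSizeCounterexample L →
    let open FiniteLattice L in
    ¬ (∃[ m ] ∃[ j ] (MeetIrreducible poset m × JoinIrreducible poset j × m ≺ j))
theorem2p3 record { lattice = lattice ; size = ℕ.suc s ; enumeration = enumeration }
  (L-counterexample , minimal) (m , j , m-irr , j-irr , m≺j) =
  minimal (L⁻ m-irr , counterexample⁻ m-irr L-counterexample j-irr m≺j , ℕ.≤-refl)
  where open DeleteMeetIrreducible lattice enumeration
theorem2p3 record { size = ℕ.zero } ((() , _) , _)
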